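{- Let $m$ be a non-negative integer, let $\mathbb{F}_q$ be a finite field with $q=p^r$ elements, $p$ prime, and let $z\in\mathbb{F}_q$. Then the number $\tilde{P}_m(z)$ of partitions of $z$ into $m$ parts over $\mathbb{F}_q$ is $$\tilde{P}_m(z)=\frac{1}{q}\binom{q+m-2}{m}+D_m(z),$$ where $$D_m(z)=\begin{cases} 0, & \text{if } m\not\equiv 0 \pmod p \text{ and } m\not\equiv 1 \pmod p;\\ \frac{q-1}{q}\binom{q/p-1+j}{j}, & \text{if } m=jp,\ j\ge 0, \text{ and } z=0;\\ -\frac{q-1}{q}\binom{q/p-1+j}{j}, & \text{if } m=jp+1,\ j\ge 0, \text{ and } z=0;\\ -\frac{1}{q}\binom{q/p-1+j}{j}, & \text{if } m=jp,\ j\ge 0, \text{ and } z\in\mathbb{F}_q^*;\\ \frac{1}{q}\binom{q/p-1+j}{j}, & \text{if } m=jp+1,\ j\ge 0, \text{ and } z\in\mathbb{F}_q^*. \end{cases}$$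
   Context: A partition of $z\in\mathbb{F}_q$ into $m$ parts is a multiset of $m$ elements of $\mathbb{F}_q^*=\mathbb{F}_q\setminus\{0\}$ (repetitions allowed, order irrelevant) whose sum is $z$; $\tilde{P}_m(z)$ denotes the number of such multisets. For $m=0$ the only multiset is the empty one, with sum $0$, so $\tilde{P}_0(0)=1$ and $\tilde{P}_0(z)=0$ for $z\neq 0$. -}

module Defs where

open import Level using (Level)
open import Algebra.Bundles using (CommutativeRing)
open import Function.Bundles using (Inverse)
open import Relation.Binary.PropositionalEquality as ≡ using (_≡_)
open import Relation.Nullary using (¬_; yes; no)
open import Relation.Nullary.Decidable using (_×-dec_)
open import Data.Product using (∃; _×_)
open import Data.Nat as ℕ using (ℕ; zero; suc; _∸_; _^_; NonZero)
open import Data.Nat.DivMod using (_/_; _%_)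
open import Data.Nat.Primality using (Prime; prime⇒nonZero)
open import Data.Nat.Combinatorics using (_C_)
open import Data.Nat.Properties using (m^n≢0)
open import Data.Fin as Fin using (Fin)
open import Data.Vec using (Vec; []; _∷_; lookup)
open import Data.List using (List; []; _∷_; map; concatMap; upTo; allFin; foldr; filter; length)
open import Data.Integer as ℤ using (ℤ; +_)
open import Data.Rational as ℚ using (ℚ)

record IsField {c ℓ : Level} (F : CommutativeRing c ℓ) : Set (c Level.⊔ ℓ) where
  open CommutativeRing F
  field
    nontrivial : ¬ (1# ≈ 0#)
    inverse    : ∀ x → ¬ (x ≈ 0#) → ∃ λ y → x * y ≈ 1#

FiniteWith : {c ℓ : Level} (F : CommutativeRing c ℓ) (q : ℕ) → Set _
FiniteWith F q = Inverse (CommutativeRing.setoid F) (≡.setoid (Fin q))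

comps : (k m : ℕ) → List (Vec ℕ k)
comps zero zero = [] ∷ []
comps zero (suc m) = []
comps (suc k) m = concatMap (λ i → map (i ∷_) (comps k (m ∸ i))) (upTo (suc m))

module _ {c ℓ : Level} (F : CommutativeRing c ℓ) {q : ℕ} (enum : FiniteWith F q) where
  open CommutativeRing F
  open Inverse enum

  times : ℕ → Carrier → Carrier
  times zero x = 0#
  times (suc n) x = x + times n x

  -- A multiset over F is encoded by its multiplicity vector (indexed via enum);
  -- its sum is Σ_i mult(i) • element(i).
  msetSum : Vec ℕ q → Carrier
  msetSum v = foldr (λ i acc → times (lookup v i) (from i) + acc) 0# (allFin q)

  -- P̃_m(z): number of multisets of m elements of F* (multiplicity of 0 is 0)
  -- whose sum is z.
  Ptilde : ℕ → Carrier → ℕ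
  Ptilde m z = length (filter (λ v → (lookup v (to 0#) ℕ.≟ 0) ×-dec (to (msetSum v) Fin.≟ to z)) (comps q m))

pow-nonZero : ∀ {p} → Prime p → ∀ r → NonZero (p ^ r)
pow-nonZero {p} pr r = m^n≢0 p r {{prime⇒nonZero pr}}

module _ {c ℓ : Level} (F : CommutativeRing c ℓ) {p : ℕ} (r : ℕ) (pr : Prime p)
         (enum : FiniteWith F (p ^ r)) where
  open CommutativeRing F
  open Inverse enum

  private
    q = p ^ r
    instance
      pNZ : NonZero p
      pNZ = prime⇒nonZero pr
      qNZ : NonZero q
      qNZ = pow-nonZero pr r

  D : ℕ → Carrier → ℚ
  D m z with m % p ℕ.≟ 0 | m % p ℕ.≟ 1 | to z Fin.≟ to 0#
  ... | yes _ | _ | yes _ = (+ ((q ∸ 1) ℕ.* B)) ℚ./ q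
    where B = ((q / p) ∸ 1 ℕ.+ m / p) C (m / p)
  ... | yes _ | _ | no _ = ℚ.- ((+ B) ℚ./ q)
    where B = ((q / p) ∸ 1 ℕ.+ m / p) C (m / p)
  ... | no _ | yes _ | yes _ = ℚ.- ((+ ((q ∸ 1) ℕ.* B)) ℚ./ q)
    where B = ((q / p) ∸ 1 ℕ.+ m / p) C (m / p)
  ... | no _ | yes _ | no _ = (+ B) ℚ./ q
    where B = ((q / p) ∸ 1 ℕ.+ m / p) C (m / p)
  ... | no _ | no _ | _ = ℚ.0ℚ

{-# OPTIONS --safe #-}

-- Let N_m(z) count the multisets of m elements of F (0 allowed) with sum z, and let
-- T_m = C(q+m-1, m) be the number of all multisets of size m.  Marking one of the m
-- elements, and recording how many copies k of it are taken off, gives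
--   m N_m(z) = Σ_{k=1}^m Σ_{a∈F} N_{m-k}(z - k a).
-- If p ∤ k then a ↦ z - k a is a bijection and the inner sum is T_{m-k}; if p ∣ k it is
-- q N_{m-k}(z).  As m T_m = q Σ_{k=1}^m T_{m-k}, the excess E_m = q N_m(z) - T_m satisfies
--   m E_m = q Σ_{p∣k} E_{m-k},
-- whose solution is E_{jp} = E_0 C(q/p-1+j, j) and E_m = 0 for p ∤ m, where
-- E_0 = q [z = 0] - 1.  Finally P̃_m(z) = N_m(z) - N_{m-1}(z), since a multiset
-- containing 0 is a smaller multiset with a 0 added.

module Submission where

module Counting where

  open import Data.Nat as ℕ using (ℕ; zero; suc)
  import Data.Nat.Properties as ℕ
  open import Data.Nat.Tactic.RingSolver using () renaming (solve-∀ to ℕ-solve-∀)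
  open import Data.Nat.Combinatorics using (_C_; nCk+nC[k+1]≡[n+1]C[k+1]; nCn≡1)
  open import Data.Nat.Divisibility using (_∣_; _∣?_; ∣m+n∣m⇒∣n; ∣m∣n⇒∣m+n; ∣-refl; >⇒∤)
  open import Data.Integer using (ℤ; +_; 0ℤ; 1ℤ; _+_; _*_; _-_)
  open import Data.Integer.Properties
  open import Data.Integer.Tactic.RingSolver using (solve-∀)
  open import Data.Bool using (true; false; if_then_else_)
  open import Data.Fin using (Fin; zero; suc)
  open import Data.List as List using (List; []; _∷_; _++_; concatMap; applyUpTo; upTo; filter; length)
  open import Data.Vec using (Vec; []; _∷_; lookup; replicate; updateAt)
  open import Algebra.Properties.Semiring.Sum +-*-semiring using (sum; sum-cong-≗; ∑-distrib-+; *-distribʳ-sum)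
  open import Function using (_∘_)
  open import Relation.Unary using (Pred; Decidable)
  open import Relation.Nullary using (¬_; Dec; yes; no; does)
  open import Relation.Nullary.Decidable using (_×-dec_; dec-true; dec-false)
  open import Relation.Nullary.Negation using (contradiction)
  open import Relation.Binary.PropositionalEquality
  open import Defs using (comps)
  open ≡-Reasoning

  -- Multiset coefficients and their absorption identity.

  -- Equals the binomial coefficient `C(n + m - 1, m)`. It follows the recursion of `∑comps`, so
  -- that counting all multisets is immediate, and `n = 0` involves no truncated subtraction.
  multichoose : ℕ → ℕ → ℕ
  multichoose zero    zero    = 1
  multichoose zero    (suc m) = 0
  multichoose (suc n) zero    = multichoose n zero
  multichoose (suc n) (suc m) = multichoose n (suc m) ℕ.+ multichoose (suc n) m

  multichoose-0 : ∀ n → multichoose n 0 ≡ 1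
  multichoose-0 zero    = refl
  multichoose-0 (suc n) = multichoose-0 n

  multichoose≡C : ∀ n m → multichoose (suc n) m ≡ (n ℕ.+ m) C m
  multichoose≡C n zero = trans (multichoose-0 n) (sym (nC0≡1 (n ℕ.+ 0)))
    where
    nC0≡1 : ∀ k → k C 0 ≡ 1
    nC0≡1 zero    = refl
    nC0≡1 (suc k) = refl
  multichoose≡C zero (suc m) = begin
    multichoose 1 m  ≡⟨ multichoose≡C 0 m ⟩
    m C m            ≡⟨ nCn≡1 m ⟩
    1                ≡⟨ nCn≡1 (suc m) ⟨
    suc m C suc m    ∎
  multichoose≡C (suc n) (suc m) = begin
    multichoose (suc n) (suc m) ℕ.+ multichoose (suc (suc n)) m
      ≡⟨ cong₂ ℕ._+_ (multichoose≡C n (suc m)) (multichoose≡C (suc n) m) ⟩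
    (n ℕ.+ suc m) C suc m ℕ.+ (suc n ℕ.+ m) C m
      ≡⟨ cong (λ k → k C suc m ℕ.+ (suc n ℕ.+ m) C m) (ℕ.+-suc n m) ⟩
    (suc n ℕ.+ m) C suc m ℕ.+ (suc n ℕ.+ m) C m
      ≡⟨ ℕ.+-comm ((suc n ℕ.+ m) C suc m) _ ⟩
    (suc n ℕ.+ m) C m ℕ.+ (suc n ℕ.+ m) C suc m
      ≡⟨ nCk+nC[k+1]≡[n+1]C[k+1] (suc n ℕ.+ m) m ⟩
    suc (suc n ℕ.+ m) C suc m
      ≡⟨ cong (λ k → suc k C suc m) (ℕ.+-suc n m) ⟨
    (suc n ℕ.+ suc m) C suc m ∎

  -- The absorption identity `(m+1) C(n+m, m+1) = n C(n+m, m)`, obtained from Pascal's rule by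
  -- induction. It yields the recursion for the total count and later solves the one for the excess.
  multichoose-absorb : ∀ n m → suc m ℕ.* multichoose n (suc m) ≡ n ℕ.* multichoose (suc n) m
  multichoose-absorb zero m = ℕ.*-zeroʳ (suc m)
  multichoose-absorb (suc n) zero = begin
    1 ℕ.* (multichoose n 1 ℕ.+ multichoose n 0)
      ≡⟨ ℕ.*-distribˡ-+ 1 (multichoose n 1) _ ⟩
    1 ℕ.* multichoose n 1 ℕ.+ 1 ℕ.* multichoose n 0
      ≡⟨ cong₂ ℕ._+_ (multichoose-absorb n zero) (ℕ.*-identityˡ _) ⟩
    n ℕ.* multichoose n 0 ℕ.+ multichoose n 0
      ≡⟨ ℕ.+-comm _ (multichoose n 0) ⟩
    suc n ℕ.* multichoose n 0 ∎
  multichoose-absorb (suc n) (suc m) = begin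
    suc (suc m) ℕ.* (multichoose n (suc (suc m)) ℕ.+ b)
      ≡⟨ ℕ.*-distribˡ-+ (suc (suc m)) (multichoose n (suc (suc m))) b ⟩
    suc (suc m) ℕ.* multichoose n (suc (suc m)) ℕ.+ (b ℕ.+ suc m ℕ.* b)
      ≡⟨ cong₂ (λ x y → x ℕ.+ (b ℕ.+ y)) (multichoose-absorb n (suc m)) (multichoose-absorb (suc n) m) ⟩
    n ℕ.* b ℕ.+ (b ℕ.+ suc n ℕ.* c)
      ≡⟨ rearrange n b c ⟩
    suc n ℕ.* (b ℕ.+ c) ∎
    where
    b = multichoose (suc n) (suc m)
    c = multichoose (suc (suc n)) m
    rearrange : ∀ n b c → n ℕ.* b ℕ.+ (b ℕ.+ suc n ℕ.* c) ≡ suc n ℕ.* (b ℕ.+ c)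
    rearrange = ℕ-solve-∀

  -- Sums over pairs of indices with prescribed total.

  -- conv h m is the sum of h k i over all k, i with k + i + 1 = m.
  conv : (ℕ → ℕ → ℤ) → ℕ → ℤ
  conv h zero    = 0ℤ
  conv h (suc m) = h 0 m + conv (h ∘ suc) m

  conv-cong : ∀ {h g} → (∀ k i → h k i ≡ g k i) → ∀ m → conv h m ≡ conv g m
  conv-cong h≡g zero    = refl
  conv-cong h≡g (suc m) = cong₂ _+_ (h≡g 0 m) (conv-cong (λ k → h≡g (suc k)) m)

  conv-- : ∀ h g m → conv h m - conv g m ≡ conv (λ k i → h k i - g k i) m
  conv-- h g zero    = refl
  conv-- h g (suc m) = begin
    (h 0 m + conv (h ∘ suc) m) - (g 0 m + conv (g ∘ suc) m)
      ≡⟨ rearrange (h 0 m) (conv (h ∘ suc) m) (g 0 m) (conv (g ∘ suc) m) ⟩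
    (h 0 m - g 0 m) + (conv (h ∘ suc) m - conv (g ∘ suc) m)
      ≡⟨ cong (_+_ (h 0 m - g 0 m)) (conv-- (h ∘ suc) (g ∘ suc) m) ⟩
    (h 0 m - g 0 m) + conv (λ k i → h (suc k) i - g (suc k) i) m ∎
    where
    rearrange : ∀ a b c d → (a + b) - (c + d) ≡ (a - c) + (b - d)
    rearrange = solve-∀

  sum-conv : ∀ {n} (h : Fin n → ℕ → ℕ → ℤ) m →
             sum (λ j → conv (h j) m) ≡ conv (λ k i → sum (λ j → h j k i)) m
  sum-conv {zero}  h zero    = refl
  sum-conv {suc n} h zero    = trans (+-identityˡ _) (sum-conv (h ∘ suc) zero)
  sum-conv h (suc m) = trans (∑-distrib-+ (λ j → h j 0 m) (λ j → conv (h j ∘ suc) m))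
                             (cong (_+_ (sum (λ j → h j 0 m))) (sum-conv (λ j → h j ∘ suc) m))

  conv-vanish : ∀ h m → (∀ k i → k ℕ.< m → h k i ≡ 0ℤ) → conv h m ≡ 0ℤ
  conv-vanish h zero    h≡0 = refl
  conv-vanish h (suc m) h≡0 = cong₂ _+_ (h≡0 0 m ℕ.z<s)
    (conv-vanish (h ∘ suc) m (λ k i k<m → h≡0 (suc k) i (ℕ.s<s k<m)))

  conv-skip : ∀ t h m → (∀ k i → k ℕ.< t → h k i ≡ 0ℤ) →
              conv h (t ℕ.+ m) ≡ conv (λ k → h (t ℕ.+ k)) m
  conv-skip zero    h m h≡0 = refl
  conv-skip (suc t) h m h≡0 = trans
    (cong₂ _+_ (h≡0 0 (t ℕ.+ m) ℕ.z<s)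
      (conv-skip t (h ∘ suc) m (λ k i k<t → h≡0 (suc k) i (ℕ.s<s k<t))))
    (+-identityˡ _)

  -- Hockey-stick summation: every new term is one step of the Pascal recursion.
  conv-multichoose : ∀ n m → conv (λ _ i → + multichoose n i) (suc m) ≡ + multichoose (suc n) m
  conv-multichoose n zero    = +-identityʳ _
  conv-multichoose n (suc m) = cong (_+_ (+ multichoose n (suc m))) (conv-multichoose n m)

  -- Coefficient form of `x f' = n x/(1-x) f` for `f = (1-x)^(-n)`: absorption, followed by the
  -- hockey-stick sum.
  multichoose-euler : ∀ n m → + m * + multichoose n m ≡ + n * conv (λ _ i → + multichoose n i) m
  multichoose-euler n zero    = sym (*-zeroʳ (+ n))
  multichoose-euler n (suc m) = begin
    + suc m * + multichoose n (suc m)   ≡⟨ pos-* (suc m) _ ⟨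
    + (suc m ℕ.* multichoose n (suc m)) ≡⟨ cong +_ (multichoose-absorb n m) ⟩
    + (n ℕ.* multichoose (suc n) m)     ≡⟨ pos-* n _ ⟩
    + n * + multichoose (suc n) m       ≡⟨ cong (+ n *_) (conv-multichoose n m) ⟨
    + n * conv (λ _ i → + multichoose n i) (suc m) ∎

  -- Weighted sums over multiplicity vectors.

  -- The total weight of comps n m, in a Pascal-type recursion: either the first
  -- multiplicity is 0, or it can be lowered by 1.
  ∑comps : ∀ n → ℕ → (Vec ℕ n → ℤ) → ℤ
  ∑comps zero    zero    P = P []
  ∑comps zero    (suc m) P = 0ℤ
  ∑comps (suc n) zero    P = ∑comps n zero (P ∘ (0 ∷_))
  ∑comps (suc n) (suc m) P = ∑comps n (suc m) (P ∘ (0 ∷_)) + ∑comps (suc n) m (λ v → P (updateAt v zero suc))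

  ∑comps-cong : ∀ n m {P Q} → (∀ v → P v ≡ Q v) → ∑comps n m P ≡ ∑comps n m Q
  ∑comps-cong zero    zero    P≡Q = P≡Q []
  ∑comps-cong zero    (suc m) P≡Q = refl
  ∑comps-cong (suc n) zero    P≡Q = ∑comps-cong n zero (λ v → P≡Q (0 ∷ v))
  ∑comps-cong (suc n) (suc m) P≡Q = cong₂ _+_ (∑comps-cong n (suc m) (λ v → P≡Q (0 ∷ v)))
                                              (∑comps-cong (suc n) m (λ v → P≡Q (updateAt v zero suc)))

  ∑comps-zero : ∀ n m → ∑comps n m (λ _ → 0ℤ) ≡ 0ℤ
  ∑comps-zero zero    zero    = refl
  ∑comps-zero zero    (suc m) = refl
  ∑comps-zero (suc n) zero    = ∑comps-zero n zero
  ∑comps-zero (suc n) (suc m) = cong₂ _+_ (∑comps-zero n (suc m)) (∑comps-zero (suc n) m)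

  ∑comps-one : ∀ n m → ∑comps n m (λ _ → 1ℤ) ≡ + multichoose n m
  ∑comps-one zero    zero    = refl
  ∑comps-one zero    (suc m) = refl
  ∑comps-one (suc n) zero    = ∑comps-one n zero
  ∑comps-one (suc n) (suc m) = cong₂ _+_ (∑comps-one n (suc m)) (∑comps-one (suc n) m)

  ∑comps-+ : ∀ n m P Q → ∑comps n m (λ v → P v + Q v) ≡ ∑comps n m P + ∑comps n m Q
  ∑comps-+ zero    zero    P Q = refl
  ∑comps-+ zero    (suc m) P Q = refl
  ∑comps-+ (suc n) zero    P Q = ∑comps-+ n zero (P ∘ (0 ∷_)) (Q ∘ (0 ∷_))
  ∑comps-+ (suc n) (suc m) P Q = trans
    (cong₂ _+_ (∑comps-+ n (suc m) (P ∘ (0 ∷_)) (Q ∘ (0 ∷_)))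
               (∑comps-+ (suc n) m (λ v → P (updateAt v zero suc)) (λ v → Q (updateAt v zero suc))))
    (rearrange (∑comps n (suc m) (P ∘ (0 ∷_))) _ _ _)
    where
    rearrange : ∀ a b c d → (a + b) + (c + d) ≡ (a + c) + (b + d)
    rearrange = solve-∀

  ∑comps-*ˡ : ∀ n m a P → ∑comps n m (λ v → a * P v) ≡ a * ∑comps n m P
  ∑comps-*ˡ zero    zero    a P = refl
  ∑comps-*ˡ zero    (suc m) a P = sym (*-zeroʳ a)
  ∑comps-*ˡ (suc n) zero    a P = ∑comps-*ˡ n zero a (P ∘ (0 ∷_))
  ∑comps-*ˡ (suc n) (suc m) a P = trans
    (cong₂ _+_ (∑comps-*ˡ n (suc m) a (P ∘ (0 ∷_))) (∑comps-*ˡ (suc n) m a (λ v → P (updateAt v zero suc))))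
    (sym (*-distribˡ-+ a _ _))

  ∑comps-sum : ∀ n m {l} (P : Fin l → Vec ℕ n → ℤ) →
               ∑comps n m (λ v → sum (λ j → P j v)) ≡ sum (λ j → ∑comps n m (P j))
  ∑comps-sum n m {zero}  P = ∑comps-zero n m
  ∑comps-sum n m {suc l} P = trans (∑comps-+ n m (P zero) (λ v → sum (λ j → P (suc j) v)))
                                   (cong (_+_ (∑comps n m (P zero))) (∑comps-sum n m (P ∘ suc)))

  ∑comps-at-0 : ∀ n P → ∑comps n 0 P ≡ P (replicate n 0)
  ∑comps-at-0 zero    P = refl
  ∑comps-at-0 (suc n) P = ∑comps-at-0 n (P ∘ (0 ∷_))

  lookup-replicate-0 : ∀ {n} (j : Fin n) → lookup (replicate n 0) j ≡ 0
  lookup-replicate-0 zero    = refl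
  lookup-replicate-0 (suc j) = lookup-replicate-0 j

  -- Indicators of decidable propositions and finite sums.

  indicator : ∀ {a} {A : Set a} → Dec A → ℤ
  indicator d = if does d then 1ℤ else 0ℤ

  indicator-yes : ∀ {a} {A : Set a} (d : Dec A) → A → indicator d ≡ 1ℤ
  indicator-yes d a = cong (if_then 1ℤ else 0ℤ) (dec-true d a)

  indicator-no : ∀ {a} {A : Set a} (d : Dec A) → ¬ A → indicator d ≡ 0ℤ
  indicator-no d ¬a = cong (if_then 1ℤ else 0ℤ) (dec-false d ¬a)

  indicator-×-dec : ∀ {a b} {A : Set a} {B : Set b} (d : Dec A) (e : Dec B) →
                    indicator (d ×-dec e) ≡ indicator d * indicator e
  indicator-×-dec d e with does d | does e
  ... | true  | true  = refl
  ... | true  | false = refl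
  ... | false | _     = refl

  indicator-cong : ∀ {a b} {A : Set a} {B : Set b} (d : Dec A) (e : Dec B) →
                   (A → B) → (B → A) → indicator d ≡ indicator e
  indicator-cong d (yes b) f g = indicator-yes d (g b)
  indicator-cong d (no ¬b) f g = indicator-no d (¬b ∘ f)

  sum-zero : ∀ {n} {f : Fin n → ℤ} → (∀ j → f j ≡ 0ℤ) → sum f ≡ 0ℤ
  sum-zero {zero}  f≡0 = refl
  sum-zero {suc n} f≡0 = cong₂ _+_ (f≡0 zero) (sum-zero (f≡0 ∘ suc))

  sum-const : ∀ n a → sum {n} (λ _ → a) ≡ + n * a
  sum-const zero    a = refl
  sum-const (suc n) a = trans (cong (_+_ a) (sum-const n a)) (sym (suc-* (+ n) a))

  sum-single : ∀ {n} (f : Fin n → ℤ) j → f j ≡ 1ℤ → (∀ i → i ≢ j → f i ≡ 0ℤ) → sum f ≡ 1ℤ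
  sum-single f zero    fj≡1 f≡0 = cong₂ _+_ fj≡1 (sum-zero (λ i → f≡0 (suc i) λ ()))
  sum-single f (suc j) fj≡1 f≡0 = cong₂ _+_ (f≡0 zero λ ())
    (sum-single (f ∘ suc) j fj≡1 (λ i i≢j → f≡0 (suc i) λ { refl → i≢j refl }))

  -- From the list enumeration `comps` to the recursive sum.

  ∑list : ∀ {a} {A : Set a} → (A → ℤ) → List A → ℤ
  ∑list P []       = 0ℤ
  ∑list P (x ∷ xs) = P x + ∑list P xs

  ∑list-++ : ∀ {a} {A : Set a} (P : A → ℤ) xs ys → ∑list P (xs ++ ys) ≡ ∑list P xs + ∑list P ys
  ∑list-++ P []       ys = sym (+-identityˡ _)
  ∑list-++ P (x ∷ xs) ys = trans (cong (_+_ (P x)) (∑list-++ P xs ys)) (sym (+-assoc (P x) _ _))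

  ∑list-map : ∀ {a b} {A : Set a} {B : Set b} (P : B → ℤ) (f : A → B) xs →
              ∑list P (List.map f xs) ≡ ∑list (P ∘ f) xs
  ∑list-map P f []       = refl
  ∑list-map P f (x ∷ xs) = cong (_+_ (P (f x))) (∑list-map P f xs)

  ∑list-concatMap : ∀ {a b} {A : Set a} {B : Set b} (P : B → ℤ) (f : A → List B) xs →
                    ∑list P (concatMap f xs) ≡ ∑list (∑list P ∘ f) xs
  ∑list-concatMap P f []       = refl
  ∑list-concatMap P f (x ∷ xs) = trans (∑list-++ P (f x) _) (cong (_+_ (∑list P (f x))) (∑list-concatMap P f xs))

  ∑list-cong : ∀ {a} {A : Set a} {P Q : A → ℤ} → (∀ x → P x ≡ Q x) → ∀ xs → ∑list P xs ≡ ∑list Q xs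
  ∑list-cong P≡Q []       = refl
  ∑list-cong P≡Q (x ∷ xs) = cong₂ _+_ (P≡Q x) (∑list-cong P≡Q xs)

  -- The tail of `upTo (suc n)` is `applyUpTo suc n`; this moves the index shift into the summand.
  ∑list-applyUpTo : ∀ {a} {A : Set a} (P : A → ℤ) (f : ℕ → A) n →
                    ∑list P (applyUpTo f n) ≡ ∑list (P ∘ f) (upTo n)
  ∑list-applyUpTo P f zero    = refl
  ∑list-applyUpTo P f (suc n) = cong (_+_ (P (f 0)))
    (trans (∑list-applyUpTo P (f ∘ suc) n) (sym (∑list-applyUpTo (P ∘ f) suc n)))

  ∑list-comps : ∀ n m P → ∑list P (comps (suc n) m) ≡
                ∑list (λ i → ∑list (P ∘ (i ∷_)) (comps n (m ℕ.∸ i))) (upTo (suc m))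
  ∑list-comps n m P = trans (∑list-concatMap P (λ i → List.map (i ∷_) (comps n (m ℕ.∸ i))) (upTo (suc m)))
    (∑list-cong (λ i → ∑list-map P (i ∷_) (comps n (m ℕ.∸ i))) (upTo (suc m)))

  -- `comps` splits by the exact first multiplicity, `∑comps` only by whether it is 0. The terms
  -- with first multiplicity at least 1 together form the sum over `comps (suc n) m` with weight
  -- `P′`.
  ∑list-comps≡∑comps : ∀ n m P → ∑list P (comps n m) ≡ ∑comps n m P
  ∑list-comps≡∑comps zero    zero    P = +-identityʳ (P [])
  ∑list-comps≡∑comps zero    (suc m) P = refl
  ∑list-comps≡∑comps (suc n) zero    P = begin
    ∑list P (comps (suc n) 0)                ≡⟨ ∑list-comps n 0 P ⟩
    ∑list (P ∘ (0 ∷_)) (comps n 0) + 0ℤ      ≡⟨ +-identityʳ _ ⟩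
    ∑list (P ∘ (0 ∷_)) (comps n 0)           ≡⟨ ∑list-comps≡∑comps n 0 (P ∘ (0 ∷_)) ⟩
    ∑comps n 0 (P ∘ (0 ∷_))                  ∎
  ∑list-comps≡∑comps (suc n) (suc m) P = begin
    ∑list P (comps (suc n) (suc m))
      ≡⟨ ∑list-comps n (suc m) P ⟩
    ∑list (P ∘ (0 ∷_)) (comps n (suc m)) + ∑list R (applyUpTo suc (suc m))
      ≡⟨ cong₂ _+_ (∑list-comps≡∑comps n (suc m) (P ∘ (0 ∷_))) (∑list-applyUpTo R suc (suc m)) ⟩
    ∑comps n (suc m) (P ∘ (0 ∷_)) + ∑list (R ∘ suc) (upTo (suc m))
      -- `suc m ∸ suc i` reduces to `m ∸ i`, and raising the head of `i ∷ v` gives `suc i ∷ v`, so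
      -- `R ∘ suc` is the summand of this expansion.
      ≡⟨ cong (_+_ (∑comps n (suc m) (P ∘ (0 ∷_)))) (∑list-comps n m P′) ⟨
    ∑comps n (suc m) (P ∘ (0 ∷_)) + ∑list P′ (comps (suc n) m)
      ≡⟨ cong (_+_ (∑comps n (suc m) (P ∘ (0 ∷_)))) (∑list-comps≡∑comps (suc n) m P′) ⟩
    ∑comps n (suc m) (P ∘ (0 ∷_)) + ∑comps (suc n) m P′ ∎
    where
    R : ℕ → ℤ
    R i = ∑list (P ∘ (i ∷_)) (comps n (suc m ℕ.∸ i))
    P′ : Vec ℕ (suc n) → ℤ
    P′ v = P (updateAt v zero suc)

  length-filter≡∑list : ∀ {a p} {A : Set a} {P : Pred A p} (P? : Decidable P) xs →
                        + length (filter P? xs) ≡ ∑list (indicator ∘ P?) xs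
  length-filter≡∑list P? []       = refl
  length-filter≡∑list P? (x ∷ xs) with does (P? x)
  ... | true  = cong (_+_ 1ℤ) (length-filter≡∑list P? xs)
  ... | false = trans (length-filter≡∑list P? xs) (sym (+-identityˡ _))

  -- Removing and marking elements of a multiset.

  -- For `j = zero` this is the defining recursion. At a later position, lowering the head and
  -- lowering entry `j` commute, so the induction hypotheses for the two branches recombine.
  ∑comps-remove : ∀ n m (j : Fin n) P → ∑comps n (suc m) P ≡
    ∑comps n (suc m) (λ v → indicator (lookup v j ℕ.≟ 0) * P v) + ∑comps n m (λ v → P (updateAt v j suc))
  ∑comps-remove (suc n) m zero P = cong (_+ ∑comps (suc n) m P′) (begin
    ∑comps n (suc m) (P ∘ (0 ∷_))
      ≡⟨ ∑comps-cong n (suc m) (λ v → *-identityˡ (P (0 ∷ v))) ⟨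
    ∑comps n (suc m) (λ v → 1ℤ * P (0 ∷ v))
      ≡⟨ +-identityʳ _ ⟨
    ∑comps n (suc m) (λ v → 1ℤ * P (0 ∷ v)) + 0ℤ
      -- A raised head is never 0, so the indicator kills the second branch.
      ≡⟨ cong (_+_ (∑comps n (suc m) (λ v → 1ℤ * P (0 ∷ v))))
           (trans (∑comps-cong (suc n) m (λ { (x ∷ v) → refl })) (∑comps-zero (suc n) m)) ⟨
    ∑comps (suc n) (suc m) (λ v → indicator (lookup v zero ℕ.≟ 0) * P v) ∎)
    where
    P′ : Vec ℕ (suc n) → ℤ
    P′ v = P (updateAt v zero suc)
  ∑comps-remove (suc n) zero (suc j) P = begin
    ∑comps n 1 (P ∘ (0 ∷_)) + ∑comps n 0 (P ∘ (1 ∷_))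
      ≡⟨ cong₂ _+_ (∑comps-remove n 0 j (P ∘ (0 ∷_))) drop ⟩
    (a + b) + c
      ≡⟨ rearrange a b c ⟩
    (a + c) + b ∎
    where
    a = ∑comps n 1 (λ v → indicator (lookup v j ℕ.≟ 0) * P (0 ∷ v))
    b = ∑comps n 0 (λ v → P (0 ∷ updateAt v j suc))
    c = ∑comps n 0 (λ v → indicator (lookup v j ℕ.≟ 0) * P (1 ∷ v))
    -- With the single unit at the head, every other multiplicity is 0, so the indicator at `j`
    -- equals 1 and may be inserted.
    drop : ∑comps n 0 (P ∘ (1 ∷_)) ≡ c
    drop = begin
      ∑comps n 0 (P ∘ (1 ∷_))        ≡⟨ ∑comps-at-0 n (P ∘ (1 ∷_)) ⟩
      P (1 ∷ replicate n 0)          ≡⟨ *-identityˡ _ ⟨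
      1ℤ * P (1 ∷ replicate n 0)
        ≡⟨ cong (λ i → i * P (1 ∷ replicate n 0)) (indicator-yes (_ ℕ.≟ 0) (lookup-replicate-0 j)) ⟨
      indicator (lookup (replicate n 0) j ℕ.≟ 0) * P (1 ∷ replicate n 0)
        ≡⟨ ∑comps-at-0 n _ ⟨
      c ∎
    rearrange : ∀ a b c → (a + b) + c ≡ (a + c) + b
    rearrange = solve-∀
  ∑comps-remove (suc n) (suc m) (suc j) P = begin
    ∑comps n (suc (suc m)) (P ∘ (0 ∷_)) + ∑comps (suc n) (suc m) P′
      ≡⟨ cong₂ _+_ (∑comps-remove n (suc m) j (P ∘ (0 ∷_))) (∑comps-remove (suc n) m (suc j) P′) ⟩
    (a + b) + (∑comps (suc n) (suc m) (λ v → indicator (lookup v (suc j) ℕ.≟ 0) * P′ v)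
               + ∑comps (suc n) m (λ v → P′ (updateAt v (suc j) suc)))
      -- On a cons, raising the head leaves entry `suc j` alone and commutes definitionally with
      -- raising that entry.
      ≡⟨ cong₂ (λ x y → (a + b) + (x + y))
           (∑comps-cong (suc n) (suc m) {λ v → indicator (lookup v (suc j) ℕ.≟ 0) * P′ v} {c′} (λ { (x ∷ v) → refl }))
           (∑comps-cong (suc n) m (λ { (x ∷ v) → refl })) ⟩
    (a + b) + (c + d)
      ≡⟨ rearrange a b c d ⟩
    (a + c) + (b + d) ∎
    where
    P′ : Vec ℕ (suc n) → ℤ
    P′ v = P (updateAt v zero suc)
    a = ∑comps n (suc (suc m)) (λ v → indicator (lookup v j ℕ.≟ 0) * P (0 ∷ v))
    b = ∑comps n (suc m) (λ v → P (0 ∷ updateAt v j suc))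
    c′ : Vec ℕ (suc n) → ℤ
    c′ v = indicator (lookup (updateAt v zero suc) (suc j) ℕ.≟ 0) * P′ v
    c = ∑comps (suc n) (suc m) c′
    d = ∑comps (suc n) m (λ v → P (updateAt (updateAt v zero suc) (suc j) suc))
    rearrange : ∀ a b c d → (a + b) + (c + d) ≡ (a + c) + (b + d)
    rearrange = solve-∀

  -- The multiplicities of a multiset of size `m` add up to `m`. As `∑comps` is a recursion without
  -- a membership predicate, the fact is expressed through weights: each lowering of the head
  -- accounts for one unit of size.
  ∑comps-size : ∀ n m P → ∑comps n m (λ v → sum (λ j → + lookup v j) * P v) ≡ + m * ∑comps n m P
  ∑comps-size zero    zero    P = refl
  ∑comps-size zero    (suc m) P = sym (*-zeroʳ (+ suc m))
  ∑comps-size (suc n) zero    P = trans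
    (∑comps-cong n 0 (λ v → cong (_* P (0 ∷ v)) (+-identityˡ (sum (λ j → + lookup v j)))))
    (∑comps-size n 0 (P ∘ (0 ∷_)))
  ∑comps-size (suc n) (suc m) P = begin
    ∑comps n (suc m) (λ v → sum (λ j → + lookup (0 ∷ v) j) * P (0 ∷ v))
      + ∑comps (suc n) m (λ v → sum (λ j → + lookup (updateAt v zero suc) j) * P′ v)
      ≡⟨ cong₂ _+_
           (trans (∑comps-cong n (suc m) (λ v → cong (_* P (0 ∷ v)) (+-identityˡ (sum (λ j → + lookup v j)))))
                  (∑comps-size n (suc m) (P ∘ (0 ∷_))))
           (trans (∑comps-cong (suc n) m (λ { (x ∷ v) → step (+ x) (sum (λ j → + lookup v j)) (P′ (x ∷ v)) }))
             (trans (∑comps-+ (suc n) m P′ (λ v → sum (λ j → + lookup v j) * P′ v))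
                    (cong (_+_ (∑comps (suc n) m P′)) (∑comps-size (suc n) m P′)))) ⟩
    + suc m * a + (b + + m * b)
      ≡⟨ cong (_+_ (+ suc m * a)) (suc-* (+ m) b) ⟨
    + suc m * a + + suc m * b
      ≡⟨ *-distribˡ-+ (+ suc m) a b ⟨
    + suc m * (a + b) ∎
    where
    P′ : Vec ℕ (suc n) → ℤ
    P′ v = P (updateAt v zero suc)
    a = ∑comps n (suc m) (P ∘ (0 ∷_))
    b = ∑comps (suc n) m P′
    step : ∀ x y z → ((1ℤ + x) + y) * z ≡ z + (x + y) * z
    step x y z = trans (cong (_* z) (+-assoc 1ℤ x y)) (suc-* (x + y) z)

  -- Iterated single updates with the last one outermost, so that `P′ ∘ addCopies j k` in
  -- `∑comps-mark` is definitionally `P ∘ addCopies j (suc k)`.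
  addCopies : ∀ {n} → Fin n → ℕ → Vec ℕ n → Vec ℕ n
  addCopies j zero    v = v
  addCopies j (suc k) v = updateAt (addCopies j k v) j suc

  lookup-updateAt-suc : ∀ {n} (v : Vec ℕ n) j → lookup (updateAt v j suc) j ≡ suc (lookup v j)
  lookup-updateAt-suc (x ∷ v) zero    = refl
  lookup-updateAt-suc (x ∷ v) (suc j) = lookup-updateAt-suc v j

  -- A multiplicity is the number of positive integers not exceeding it. The multisets with at least
  -- `suc k` copies of `j` arise by adding `suc k` copies to those of size `i = m - k - 1`; repeated
  -- removal of `j` produces these terms one by one.
  ∑comps-mark : ∀ n m (j : Fin n) P → ∑comps n m (λ v → + lookup v j * P v) ≡
                conv (λ k i → ∑comps n i (P ∘ addCopies j (suc k))) m
  ∑comps-mark n zero    j P = trans (∑comps-at-0 n (λ v → + lookup v j * P v))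
    (cong (λ x → + x * P (replicate n 0)) (lookup-replicate-0 j))
  ∑comps-mark n (suc m) j P = begin
    ∑comps n (suc m) (λ v → + lookup v j * P v)
      ≡⟨ ∑comps-remove n m j _ ⟩
    ∑comps n (suc m) (λ v → indicator (lookup v j ℕ.≟ 0) * (+ lookup v j * P v))
      + ∑comps n m (λ v → + lookup (updateAt v j suc) j * P′ v)
      ≡⟨ cong₂ _+_
           (trans (∑comps-cong n (suc m) (λ v → kill (lookup v j) (P v))) (∑comps-zero n (suc m)))
           (∑comps-cong n m (λ v → trans (cong (λ x → + x * P′ v) (lookup-updateAt-suc v j))
                                         (suc-* (+ lookup v j) (P′ v)))) ⟩
    0ℤ + ∑comps n m (λ v → P′ v + + lookup v j * P′ v)
      ≡⟨ +-identityˡ _ ⟩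
    ∑comps n m (λ v → P′ v + + lookup v j * P′ v)
      ≡⟨ ∑comps-+ n m P′ _ ⟩
    ∑comps n m P′ + ∑comps n m (λ v → + lookup v j * P′ v)
      ≡⟨ cong (_+_ (∑comps n m P′)) (∑comps-mark n m j P′) ⟩
    ∑comps n m P′ + conv (λ k i → ∑comps n i (P′ ∘ addCopies j (suc k))) m ∎
    where
    P′ : Vec ℕ n → ℤ
    P′ v = P (updateAt v j suc)
    kill : ∀ x a → indicator (x ℕ.≟ 0) * (+ x * a) ≡ 0ℤ
    kill zero    a = refl
    kill (suc x) a = refl

  -- Double counting of multisets with a marked element: by size on the left, by the marked element
  -- `j` and the number of copies taken off on the right. The weight 1 gives back
  -- `multichoose-euler`.
  ∑comps-euler : ∀ n m P → + m * ∑comps n m P ≡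
                 conv (λ k i → ∑comps n i (λ v → sum (λ j → P (addCopies j (suc k) v)))) m
  ∑comps-euler n m P = begin
    + m * ∑comps n m P
      ≡⟨ ∑comps-size n m P ⟨
    ∑comps n m (λ v → sum (λ j → + lookup v j) * P v)
      ≡⟨ ∑comps-cong n m (λ v → *-distribʳ-sum (P v) (λ j → + lookup v j)) ⟩
    ∑comps n m (λ v → sum (λ j → + lookup v j * P v))
      ≡⟨ ∑comps-sum n m (λ j v → + lookup v j * P v) ⟩
    sum (λ j → ∑comps n m (λ v → + lookup v j * P v))
      ≡⟨ sum-cong-≗ (λ j → ∑comps-mark n m j P) ⟩
    sum (λ j → conv (λ k i → ∑comps n i (P ∘ addCopies j (suc k))) m)
      ≡⟨ sum-conv (λ j k i → ∑comps n i (P ∘ addCopies j (suc k))) m ⟩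
    conv (λ k i → sum (λ j → ∑comps n i (P ∘ addCopies j (suc k)))) m
      ≡⟨ conv-cong (λ k i → ∑comps-sum n i (λ j → P ∘ addCopies j (suc k))) m ⟨
    conv (λ k i → ∑comps n i (λ v → sum (λ j → P (addCopies j (suc k) v)))) m ∎

  -- The recursion for the excess.

  -- The recursion of coefficients of E₀ / (1 - x^p)^(q/p).
  EulerRecursion : (p q : ℕ) → (ℕ → ℤ) → Set
  EulerRecursion p q E = ∀ m → + m * E m ≡ + q * conv (λ k i → indicator (p ∣? suc k) * E i) m

  -- This is `q` times `∑comps-euler` minus `multichoose-euler`. By `uniform` the terms with `p` not
  -- dividing `suc k` cancel; `periodic` turns the others into `q N - T`, which is the excess again.
  excess-recursion : ∀ p q (P : Vec ℕ q → ℤ) →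
    (∀ k v → p ∣ suc k → sum (λ j → P (addCopies j (suc k) v)) ≡ + q * P v) →
    (∀ k v → ¬ (p ∣ suc k) → sum (λ j → P (addCopies j (suc k) v)) ≡ 1ℤ) →
    EulerRecursion p q (λ m → + q * ∑comps q m P - + multichoose q m)
  excess-recursion p q P periodic uniform m = begin
    + m * (+ q * N m - T m)
      ≡⟨ expand (+ m) (+ q) (N m) (T m) ⟩
    + q * (+ m * N m) - + m * T m
      ≡⟨ cong₂ (λ x y → + q * x - y) (∑comps-euler q m P) (multichoose-euler q m) ⟩
    + q * conv S m - + q * conv (λ _ → T) m
      ≡⟨ factor (+ q) (conv S m) _ ⟩
    + q * (conv S m - conv (λ _ → T) m)
      ≡⟨ cong (+ q *_) (trans (conv-- S (λ _ → T) m) (conv-cong difference m)) ⟩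
    + q * conv (λ k i → indicator (p ∣? suc k) * (+ q * N i - T i)) m ∎
    where
    N T : ℕ → ℤ
    N i = ∑comps q i P
    T i = + multichoose q i
    S : ℕ → ℕ → ℤ
    S k i = ∑comps q i (λ v → sum (λ j → P (addCopies j (suc k) v)))
    expand : ∀ m q n t → m * (q * n - t) ≡ q * (m * n) - m * t
    expand = solve-∀
    factor : ∀ q a b → q * a - q * b ≡ q * (a - b)
    factor = solve-∀
    difference : ∀ k i → S k i - T i ≡ indicator (p ∣? suc k) * (+ q * N i - T i)
    difference k i with p ∣? suc k
    ... | yes p∣k = trans
      (cong (_- T i) (trans (∑comps-cong q i (λ v → periodic k v p∣k)) (∑comps-*ˡ q i (+ q) P)))
      (sym (*-identityˡ _))
    ... | no p∤k = trans
      (cong (_- T i) (trans (∑comps-cong q i (λ v → uniform k v p∤k)) (∑comps-one q i)))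
      (+-inverseʳ (T i))

  -- Solving the recursion when `q = p * s`.

  module _ (p′ s : ℕ) (E : ℕ → ℤ) (rec : EulerRecursion (suc p′) (suc p′ ℕ.* s) E) where

    private
      p = suc p′
      h : ℕ → ℕ → ℤ
      h k i = indicator (p ∣? suc k) * E i

      h-small : ∀ k i → k ℕ.< p′ → h k i ≡ 0ℤ
      h-small k i k<p′ = cong (_* E i) (indicator-no (p ∣? suc k) (>⇒∤ (ℕ.s<s k<p′)))

      H-small : ∀ m → m ℕ.< p → conv h m ≡ 0ℤ
      H-small m m<p = conv-vanish h m (λ k i k<m → h-small k i (ℕ.<-≤-trans k<m (ℕ.s≤s⁻¹ m<p)))

      -- The first `p′` terms vanish, the term at `k = p′` is `E m`, and the later ones repeat
      -- `conv h m` because divisibility by `p` has period `p`.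
      H-step : ∀ m → conv h (p ℕ.+ m) ≡ E m + conv h m
      H-step m = begin
        conv h (p ℕ.+ m)
          ≡⟨ cong (conv h) (ℕ.+-suc p′ m) ⟨
        conv h (p′ ℕ.+ suc m)
          ≡⟨ conv-skip p′ h (suc m) h-small ⟩
        h (p′ ℕ.+ 0) m + conv (λ k → h (p′ ℕ.+ suc k)) m
          ≡⟨ cong₂ _+_ (trans (cong (_* E m) (indicator-yes (p ∣? suc (p′ ℕ.+ 0))
                                (subst (λ x → p ∣ suc x) (sym (ℕ.+-identityʳ p′)) ∣-refl)))
                              (*-identityˡ (E m)))
                       (conv-cong (λ k i → cong (_* E i) (indicator-cong (p ∣? suc (p′ ℕ.+ suc k)) (p ∣? suc k)
                          (λ d → ∣m+n∣m⇒∣n d ∣-refl) (∣m∣n⇒∣m+n ∣-refl))) m) ⟩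
        E m + conv h m ∎

    -- By `H-step` the right side of the recursion at `r + j * p` involves only smaller indices of
    -- the same residue class, where `E` already vanishes. Since `r` is nonzero, the factor `m` can
    -- be cancelled.
    excess-nonmultiple : ∀ r j → r ≢ 0 → r ℕ.< p → E (r ℕ.+ j ℕ.* p) ≡ 0ℤ
    excess-nonmultiple r j r≢0 r<p = vanish (r ℕ.+ j ℕ.* p) (r≢0 ∘ ℕ.m+n≡0⇒m≡0 r) (H≡0 j)
      where
      vanish : ∀ m → m ≢ 0 → conv h m ≡ 0ℤ → E m ≡ 0ℤ
      vanish zero    m≢0 _  = contradiction refl m≢0
      vanish (suc m) _   eq = *-cancelˡ-≡ (+ suc m) (E (suc m)) 0ℤ (begin
        + suc m * E (suc m)             ≡⟨ rec (suc m) ⟩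
        + (p ℕ.* s) * conv h (suc m)    ≡⟨ cong (+ (p ℕ.* s) *_) eq ⟩
        + (p ℕ.* s) * 0ℤ                ≡⟨ *-zeroʳ (+ (p ℕ.* s)) ⟩
        0ℤ                              ≡⟨ *-zeroʳ (+ suc m) ⟨
        + suc m * 0ℤ                    ∎)
      H≡0 : ∀ j → conv h (r ℕ.+ j ℕ.* p) ≡ 0ℤ
      H≡0 zero    = H-small (r ℕ.+ 0) (subst (ℕ._< p) (sym (ℕ.+-identityʳ r)) r<p)
      H≡0 (suc j) = begin
        conv h (r ℕ.+ (p ℕ.+ j ℕ.* p))   ≡⟨ cong (conv h) (swap r p (j ℕ.* p)) ⟩
        conv h (p ℕ.+ (r ℕ.+ j ℕ.* p))   ≡⟨ H-step (r ℕ.+ j ℕ.* p) ⟩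
        E (r ℕ.+ j ℕ.* p) + conv h (r ℕ.+ j ℕ.* p)
          ≡⟨ cong₂ _+_ (vanish (r ℕ.+ j ℕ.* p) (r≢0 ∘ ℕ.m+n≡0⇒m≡0 r) (H≡0 j)) (H≡0 j) ⟩
        0ℤ ∎
        where
        swap : ∀ a b c → a ℕ.+ (b ℕ.+ c) ≡ b ℕ.+ (a ℕ.+ c)
        swap = ℕ-solve-∀

    -- Mutual induction with `H-multiple`. As `q = p * s`, the recursion at `suc j * p` carries a
    -- factor `p` on both sides; what remains is absorption for `s`.
    excess-multiple : ∀ j → E (j ℕ.* p) ≡ E 0 * + multichoose s j
    private
      -- By `H-step` the left side is the sum of `E (i * p)` over `i` up to `j`, and the Pascal
      -- recursion of `multichoose` adds up the coefficients.
      H-multiple : ∀ j → conv h (suc j ℕ.* p) ≡ E 0 * + multichoose (suc s) j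

    excess-multiple zero    = sym (trans (cong (λ x → E 0 * + x) (multichoose-0 s)) (*-identityʳ (E 0)))
    excess-multiple (suc j) = *-cancelˡ-≡ (+ (suc j ℕ.* p)) _ _ (begin
      + (suc j ℕ.* p) * E (suc j ℕ.* p)
        ≡⟨ rec (suc j ℕ.* p) ⟩
      + (p ℕ.* s) * conv h (suc j ℕ.* p)
        ≡⟨ cong₂ _*_ (pos-* p s) (H-multiple j) ⟩
      (+ p * + s) * (E 0 * + multichoose (suc s) j)
        ≡⟨ regroup (+ p) (+ s) (E 0) _ ⟩
      (+ p * E 0) * (+ s * + multichoose (suc s) j)
        ≡⟨ cong (+ p * E 0 *_) absorb ⟩
      (+ p * E 0) * (+ suc j * + multichoose s (suc j))
        ≡⟨ regroup′ (+ p) (E 0) (+ suc j) _ ⟩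
      (+ suc j * + p) * (E 0 * + multichoose s (suc j))
        ≡⟨ cong (_* (E 0 * + multichoose s (suc j))) (pos-* (suc j) p) ⟨
      + (suc j ℕ.* p) * (E 0 * + multichoose s (suc j)) ∎)
      where
      regroup : ∀ p s e c → (p * s) * (e * c) ≡ (p * e) * (s * c)
      regroup = solve-∀
      regroup′ : ∀ p e j c → (p * e) * (j * c) ≡ (j * p) * (e * c)
      regroup′ = solve-∀
      absorb : + s * + multichoose (suc s) j ≡ + suc j * + multichoose s (suc j)
      absorb = trans (sym (pos-* s _)) (trans (cong +_ (sym (multichoose-absorb s j))) (pos-* (suc j) _))

    H-multiple j = trans (H-step (j ℕ.* p)) (go j)
      where
      go : ∀ j → E (j ℕ.* p) + conv h (j ℕ.* p) ≡ E 0 * + multichoose (suc s) j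
      go zero    = trans (+-identityʳ (E 0)) (excess-multiple 0)
      go (suc j) = trans (cong₂ _+_ (excess-multiple (suc j)) (H-multiple j))
                         (sym (*-distribˡ-+ (E 0) (+ multichoose s (suc j)) _))

module FiniteField where

  open import Defs
  open import Algebra.Bundles using (CommutativeRing)
  open import Data.Nat as ℕ using (ℕ; zero; suc)
  import Data.Nat.Properties as ℕ
  open import Data.Nat.Primality using (Prime; prime⇒irreducible)
  open import Data.Nat.Coprimality using (Coprime; coprime-Bézout)
  open import Data.Nat.GCD using (module Bézout)
  open import Data.Nat.Divisibility using (_∣_; divides)
  open import Data.Integer as ℤ using (ℤ; +_; 1ℤ)
  import Data.Integer.Properties as ℤ
  open import Data.Integer.Tactic.RingSolver using (solve-∀)
  open import Data.Fin as Fin using (Fin; zero; suc)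
  import Data.Fin.Permutation as Perm
  open import Data.List using (foldr; tabulate)
  open import Data.Product using (_,_)
  open import Data.Sum using (inj₁; inj₂)
  open import Data.Vec using (Vec; _∷_; lookup; replicate; updateAt)
  open import Function using (_∘_; id)
  open import Function.Bundles using (Inverse)
  open import Relation.Nullary using (¬_; yes; no)
  open import Relation.Nullary.Negation using (contradiction)
  open import Relation.Binary.PropositionalEquality as ≡ using (_≡_; _≢_)
  import Algebra.Properties.Semiring.Sum ℤ.+-*-semiring as ℤΣ
  open Counting

  module SubsetSums {c ℓ} (F : CommutativeRing c ℓ) (F-field : IsField F) {q} (enum : FiniteWith F q) where

    open CommutativeRing F hiding (zero)
    open IsField F-field using (nontrivial) renaming (inverse to reciprocal)
    open Inverse enum using (to; from; to-cong; strictlyInverseˡ; strictlyInverseʳ)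
    open import Algebra.Properties.CommutativeMonoid.Sum +-commutativeMonoid
    open import Algebra.Properties.Semiring.Mult semiring
    open import Algebra.Properties.Group +-group using (identityʳ-unique; //-rightDividesˡ; //-rightDividesʳ; x≈z//y)
    open import Algebra.Properties.CommutativeSemigroup +-commutativeSemigroup using (x∙yz≈y∙xz)
    open import Relation.Binary.Reasoning.Setoid setoid

    -- The order and the characteristic of the field.

    to-injective : ∀ {x y} → to x ≡ to y → x ≈ y
    to-injective {x} {y} eq = begin
      x            ≈⟨ strictlyInverseʳ x ⟨
      from (to x)  ≡⟨ ≡.cong from eq ⟩
      from (to y)  ≈⟨ strictlyInverseʳ y ⟩
      y            ∎

    -- 0 and 1 have different indices. This excludes the exponent 0 and keeps the subtractions in
    -- `q ∸ 1` and `q + m ∸ 2` exact.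
    order>1 : 1 ℕ.< q
    order>1 = distinct (to 1#) (to 0#) (nontrivial ∘ to-injective)
      where
      distinct : ∀ {n} (i j : Fin n) → i ≢ j → 1 ℕ.< n
      distinct {1}           zero zero i≢j = contradiction ≡.refl i≢j
      distinct {suc (suc n)} _    _    _   = ℕ.s<s ℕ.z<s

    -- Translation by 1 permutes F, so the sum of all elements is unchanged by it.
    order×1≈0 : q × 1# ≈ 0#
    order×1≈0 = identityʳ-unique (sum from) (q × 1#) (begin
      sum from + q × 1#                  ≈⟨ +-congˡ (sum-replicate q) ⟨
      sum from + sum {q} (λ _ → 1#)      ≈⟨ ∑-distrib-+ from (λ _ → 1#) ⟨
      sum (λ i → from i + 1#)            ≈⟨ sum-cong-≋ (λ i → strictlyInverseʳ (from i + 1#)) ⟨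
      sum (λ i → from (to (from i + 1#))) ≈⟨ sum-permute from translation ⟨
      sum from                           ∎)
      where
      translation : Perm.Permutation q q
      translation = Perm.permutation (λ i → to (from i + 1#)) (λ i → to (from i - 1#))
        (λ i → ≡.trans (to-cong (trans (+-congʳ (strictlyInverseʳ _)) (//-rightDividesˡ 1# (from i)))) (strictlyInverseˡ i))
        (λ i → ≡.trans (to-cong (trans (+-congʳ (strictlyInverseʳ _)) (//-rightDividesʳ 1# (from i)))) (strictlyInverseˡ i))

    -- Either `p × 1#` is zero, or it has a reciprocal and one factor `p` cancels from the power.
    -- Descending to exponent 0 would give `1# ≈ 0#`.
    p^r×1≈0⇒p×1≈0 : ∀ p r → (p ℕ.^ r) × 1# ≈ 0# → p × 1# ≈ 0#
    p^r×1≈0⇒p×1≈0 p zero    eq = contradiction (trans (sym (+-identityʳ 1#)) eq) nontrivial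
    p^r×1≈0⇒p×1≈0 p (suc r) eq with to (p × 1#) Fin.≟ to 0#
    ... | yes p≡0 = to-injective p≡0
    ... | no p≢0 with reciprocal (p × 1#) (p≢0 ∘ to-cong)
    ... | u , pu≈1 = p^r×1≈0⇒p×1≈0 p r (begin
      p^r                      ≈⟨ *-identityˡ p^r ⟨
      1# * p^r                 ≈⟨ *-congʳ (trans (*-comm u (p × 1#)) pu≈1) ⟨
      (u * (p × 1#)) * p^r     ≈⟨ *-assoc u (p × 1#) p^r ⟩
      u * ((p × 1#) * p^r)     ≈⟨ *-congˡ (×1-homo-* p (p ℕ.^ r)) ⟨
      u * ((p ℕ.* p ℕ.^ r) × 1#)  ≈⟨ *-congˡ eq ⟩
      u * 0#                   ≈⟨ zeroʳ u ⟩
      0#                       ∎)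
      where p^r = (p ℕ.^ r) × 1#

    ×≈×1* : ∀ k x → k × x ≈ (k × 1#) * x
    ×≈×1* k x = trans (×-congʳ k (sym (*-identityˡ x))) (sym (×-assoc-* k 1# x))

    multiple×1≈0 : ∀ p d → p × 1# ≈ 0# → (d ℕ.* p) × 1# ≈ 0#
    multiple×1≈0 p d p≈0 = trans (×1-homo-* d p) (trans (*-congˡ p≈0) (zeroʳ (d × 1#)))

    ∣⇒×≈0 : ∀ {p k} → p × 1# ≈ 0# → p ∣ k → ∀ x → k × x ≈ 0#
    ∣⇒×≈0 {p} p≈0 (divides d ≡.refl) x =
      trans (×≈×1* (d ℕ.* p) x) (trans (*-congʳ (multiple×1≈0 p d p≈0)) (zeroˡ x))

    consecutive×1≉0 : ∀ a b → suc b ≡ a → b × 1# ≈ 0# → ¬ (a × 1# ≈ 0#)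
    consecutive×1≉0 _ b ≡.refl b≈0 a≈0 = nontrivial (trans (sym (+-identityʳ 1#)) (trans (+-congˡ (sym b≈0)) a≈0))

    -- Here `k` and `p` are coprime, so by Bézout some multiples of `k` and of `p` differ by one. If
    -- both vanished in the field, so would `1#`.
    ∤⇒×1≉0 : ∀ p k → Prime p → p × 1# ≈ 0# → ¬ (p ∣ k) → ¬ (k × 1# ≈ 0#)
    ∤⇒×1≉0 p k pr p≈0 p∤k k≈0 with coprime-Bézout coprime
      where
      coprime : Coprime k p
      coprime (d∣k , d∣p) with prime⇒irreducible pr d∣p
      ... | inj₁ d≡1    = d≡1
      ... | inj₂ ≡.refl = contradiction d∣k p∤k
    ... | Bézout.+- x y eq = consecutive×1≉0 _ _ eq (multiple×1≈0 p y p≈0) (multiple×1≈0 k x k≈0)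
    ... | Bézout.-+ x y eq = consecutive×1≉0 _ _ eq (multiple×1≈0 k x k≈0) (multiple×1≈0 p y p≈0)

    -- Sums of multisets in the field, and the effect of adding copies.

    times≡× : ∀ n x → times F enum n x ≡ n × x
    times≡× zero    x = ≡.refl
    times≡× (suc n) x = ≡.cong (_+_ x) (times≡× n x)

    weightedSum : ∀ {n} → (Fin n → Carrier) → Vec ℕ n → Carrier
    weightedSum x v = sum (λ i → lookup v i × x i)

    foldr-tabulate : ∀ {a n} {A : Set a} (f : A → Carrier) (g : Fin n → A) →
                     foldr (λ i acc → f i + acc) 0# (tabulate g) ≡ sum (f ∘ g)
    foldr-tabulate {n = zero}  f g = ≡.refl
    foldr-tabulate {n = suc n} f g = ≡.cong (_+_ (f (g zero))) (foldr-tabulate f (g ∘ suc))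

    msetSum≡weightedSum : ∀ v → msetSum F enum v ≡ weightedSum from v
    msetSum≡weightedSum v = ≡.trans (foldr-tabulate (λ i → times F enum (lookup v i) (from i)) id)
                                    (sum-cong-≗ (λ i → times≡× (lookup v i) (from i)))

    weightedSum-updateAt : ∀ {n} (x : Fin n → Carrier) v j →
                           weightedSum x (updateAt v j suc) ≈ x j + weightedSum x v
    weightedSum-updateAt x (k ∷ v) zero    = +-assoc (x zero) (k × x zero) _
    weightedSum-updateAt x (k ∷ v) (suc j) = trans
      (+-congˡ (weightedSum-updateAt (x ∘ suc) v j))
      (x∙yz≈y∙xz (k × x zero) (x (suc j)) _)

    weightedSum-addCopies : ∀ {n} (x : Fin n → Carrier) v j k →
                            weightedSum x (addCopies j k v) ≈ k × x j + weightedSum x v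
    weightedSum-addCopies x v j zero    = sym (+-identityˡ _)
    weightedSum-addCopies x v j (suc k) = begin
      weightedSum x (updateAt (addCopies j k v) j suc)  ≈⟨ weightedSum-updateAt x (addCopies j k v) j ⟩
      x j + weightedSum x (addCopies j k v)             ≈⟨ +-congˡ (weightedSum-addCopies x v j k) ⟩
      x j + (k × x j + weightedSum x v)                 ≈⟨ +-assoc (x j) (k × x j) _ ⟨
      x j + k × x j + weightedSum x v                   ∎

    weightedSum-replicate-0 : ∀ {n} (x : Fin n → Carrier) → weightedSum x (replicate n 0) ≈ 0#
    weightedSum-replicate-0 {zero}  x = refl
    weightedSum-replicate-0 {suc n} x = trans (+-identityˡ _) (weightedSum-replicate-0 (x ∘ suc))

    -- Equality is tested on indices because `F` is only a setoid; the order of the comparison is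
    -- that of the filter in `Ptilde`.
    δ : Carrier → Carrier → ℤ
    δ z y = indicator (to y Fin.≟ to z)

    δ-cong : ∀ z {x y} → x ≈ y → δ z x ≡ δ z y
    δ-cong z x≈y = ≡.cong (λ i → indicator (i Fin.≟ to z)) (to-cong x≈y)

    δ≡1 : ∀ {z y} → y ≈ z → δ z y ≡ 1ℤ
    δ≡1 y≈z = indicator-yes (_ Fin.≟ _) (to-cong y≈z)

    δ≡0 : ∀ {z y} → ¬ (y ≈ z) → δ z y ≡ ℤ.0ℤ
    δ≡0 y≉z = indicator-no (_ Fin.≟ _) (y≉z ∘ to-injective)

    sumIs : Carrier → Vec ℕ q → ℤ
    sumIs z v = δ z (weightedSum from v)

    -- In characteristic `p`, adding `k` copies of any element does not change the sum, so all `q`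
    -- terms agree.
    sumIs-addCopies-∣ : ∀ {p k} z v → p × 1# ≈ 0# → p ∣ k →
                        ℤΣ.sum (λ j → sumIs z (addCopies j k v)) ≡ + q ℤ.* sumIs z v
    sumIs-addCopies-∣ {k = k} z v p≈0 p∣k = ≡.trans
      (ℤΣ.sum-cong-≗ (λ j → δ-cong z (trans (weightedSum-addCopies from v j k)
                                     (trans (+-congʳ (∣⇒×≈0 p≈0 p∣k (from j))) (+-identityˡ _)))))
      (sum-const q (sumIs z v))

    -- k x + y = z has a unique solution x when k is invertible in F.
    sumIs-addCopies-∤ : ∀ k z v → ¬ (k × 1# ≈ 0#) → ℤΣ.sum (λ j → sumIs z (addCopies j k v)) ≡ 1ℤ
    sumIs-addCopies-∤ k z v k≉0 with reciprocal (k × 1#) k≉0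
    ... | u , ku≈1 = sum-single _ (to x₀) (δ≡1 solution) (λ i i≢x₀ → δ≡0 (i≢x₀ ∘ unique i))
      where
      y x₀ : Carrier
      y = weightedSum from v
      x₀ = u * (z - y)
      solution : weightedSum from (addCopies (to x₀) k v) ≈ z
      solution = begin
        weightedSum from (addCopies (to x₀) k v)  ≈⟨ weightedSum-addCopies from v (to x₀) k ⟩
        k × from (to x₀) + y               ≈⟨ +-congʳ (×-congʳ k (strictlyInverseʳ x₀)) ⟩
        k × x₀ + y                         ≈⟨ +-congʳ (×≈×1* k x₀) ⟩
        (k × 1#) * (u * (z - y)) + y       ≈⟨ +-congʳ (*-assoc (k × 1#) u (z - y)) ⟨
        (k × 1#) * u * (z - y) + y         ≈⟨ +-congʳ (*-congʳ ku≈1) ⟩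
        1# * (z - y) + y                   ≈⟨ +-congʳ (*-identityˡ (z - y)) ⟩
        (z - y) + y                        ≈⟨ //-rightDividesˡ y z ⟩
        z                                  ∎
      unique : ∀ i → weightedSum from (addCopies i k v) ≈ z → i ≡ to x₀
      unique i eq = ≡.trans (≡.sym (strictlyInverseˡ i)) (to-cong (begin
        from i                     ≈⟨ *-identityˡ (from i) ⟨
        1# * from i                ≈⟨ *-congʳ (trans (*-comm u (k × 1#)) ku≈1) ⟨
        u * (k × 1#) * from i      ≈⟨ *-assoc u (k × 1#) (from i) ⟩
        u * ((k × 1#) * from i)    ≈⟨ *-congˡ (×≈×1* k (from i)) ⟨
        u * (k × from i)           ≈⟨ *-congˡ (x≈z//y (k × from i) y z
                                        (trans (sym (weightedSum-addCopies from v i k)) eq)) ⟩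
        u * (z - y)                ∎))

  -- Partition counts as differences of consecutive excesses.

  module Partitions {c ℓ} (F : CommutativeRing c ℓ) (F-field : IsField F) (p″ r : ℕ)
                    (pr : Prime (suc (suc p″))) (enum : FiniteWith F (suc (suc p″) ℕ.^ suc r)) where

    open CommutativeRing F using (Carrier; 0#; +-identityˡ; +-congʳ; trans)
    open Inverse enum using (to; from; strictlyInverseʳ)
    open SubsetSums F F-field enum
    open ≡.≡-Reasoning

    private
      p q s : ℕ
      p = suc (suc p″)
      q = p ℕ.^ suc r
      -- `q` unfolds to `p * s`, the shape required for solving the recursion.
      s = p ℕ.^ r

    excess : Carrier → ℕ → ℤ
    excess z m = + q ℤ.* ∑comps q m (sumIs z) ℤ.- + multichoose q m

    excess-euler : ∀ z → EulerRecursion p q (excess z)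
    excess-euler z = excess-recursion p q (sumIs z)
      (λ k v p∣k → sumIs-addCopies-∣ z v p≈0 p∣k)
      (λ k v p∤k → sumIs-addCopies-∤ (suc k) z v (∤⇒×1≉0 p (suc k) pr p≈0 p∤k))
      where
      p≈0 = p^r×1≈0⇒p×1≈0 p (suc r) order×1≈0

    excess-0 : ∀ z → excess z 0 ≡ + q ℤ.* δ z 0# ℤ.- 1ℤ
    excess-0 z = ≡.cong₂ (λ a b → + q ℤ.* a ℤ.- + b)
      (≡.trans (∑comps-at-0 q (sumIs z)) (δ-cong z (weightedSum-replicate-0 from)))
      (multichoose-0 q)

    nonzeroParts : Carrier → Vec ℕ q → ℤ
    nonzeroParts z v = indicator (lookup v (to 0#) ℕ.≟ 0) ℤ.* sumIs z v

    Ptilde≡∑comps : ∀ m z → + Ptilde F enum m z ≡ ∑comps q m (nonzeroParts z)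
    Ptilde≡∑comps m z = ≡.trans (length-filter≡∑list _ (comps q m))
      (≡.trans (∑list-comps≡∑comps q m _)
        (∑comps-cong q m (λ v → ≡.trans
          (indicator-×-dec (lookup v (to 0#) ℕ.≟ 0) (to (msetSum F enum v) Fin.≟ to z))
          (≡.cong (λ y → indicator (lookup v (to 0#) ℕ.≟ 0) ℤ.* δ z y) (msetSum≡weightedSum v)))))

    -- Size 0 has no smaller size to compare with and is computed from the empty multiset; the
    -- summand 1 is `multichoose (q ∸ 1) 0`.
    Ptilde-zero : ∀ z → + q ℤ.* + Ptilde F enum 0 z ≡ 1ℤ ℤ.+ excess z 0
    Ptilde-zero z = begin
      + q ℤ.* + Ptilde F enum 0 z      ≡⟨ ≡.cong (+ q ℤ.*_) P₀ ⟩
      + q ℤ.* δ z 0#                   ≡⟨ rearrange 1ℤ (+ q ℤ.* δ z 0#) ⟨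
      1ℤ ℤ.+ (+ q ℤ.* δ z 0# ℤ.- 1ℤ)   ≡⟨ ≡.cong (ℤ._+_ 1ℤ) (excess-0 z) ⟨
      1ℤ ℤ.+ excess z 0                ∎
      where
      rearrange : ∀ a b → a ℤ.+ (b ℤ.- a) ≡ b
      rearrange = solve-∀
      P₀ : + Ptilde F enum 0 z ≡ δ z 0#
      P₀ = begin
        + Ptilde F enum 0 z                ≡⟨ Ptilde≡∑comps 0 z ⟩
        ∑comps q 0 (nonzeroParts z)        ≡⟨ ∑comps-at-0 q (nonzeroParts z) ⟩
        nonzeroParts z (replicate q 0)
          ≡⟨ ≡.cong₂ ℤ._*_ (indicator-yes (_ ℕ.≟ 0) (lookup-replicate-0 (to 0#)))
                           (δ-cong z (weightedSum-replicate-0 from)) ⟩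
        1ℤ ℤ.* δ z 0#                      ≡⟨ ℤ.*-identityˡ _ ⟩
        δ z 0#                             ∎

    -- A multiset either avoids 0 or arises from a smaller one by adding a 0.
    Ptilde-suc : ∀ m z → + q ℤ.* + Ptilde F enum (suc m) z ≡
                 + multichoose (q ℕ.∸ 1) (suc m) ℤ.+ (excess z (suc m) ℤ.- excess z m)
    Ptilde-suc m z = begin
      + q ℤ.* + Ptilde F enum (suc m) z
        ≡⟨ ≡.cong (+ q ℤ.*_) (Ptilde≡∑comps (suc m) z) ⟩
      + q ℤ.* P
        ≡⟨ rearrange (+ q) P (∑comps q m (sumIs z)) (+ multichoose (q ℕ.∸ 1) (suc m)) (+ multichoose q m) ⟩
      + multichoose (q ℕ.∸ 1) (suc m) ℤ.+
        ((+ q ℤ.* (P ℤ.+ ∑comps q m (sumIs z)) ℤ.- (+ multichoose (q ℕ.∸ 1) (suc m) ℤ.+ + multichoose q m))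
          ℤ.- excess z m)
        ≡⟨ ≡.cong₂ (λ a b → + multichoose (q ℕ.∸ 1) (suc m) ℤ.+ ((+ q ℤ.* a ℤ.- + b) ℤ.- excess z m))
             split (multichoose-pred q (ℕ.<-trans ℕ.z<s order>1)) ⟨
      + multichoose (q ℕ.∸ 1) (suc m) ℤ.+ (excess z (suc m) ℤ.- excess z m) ∎
      where
      P = ∑comps q (suc m) (nonzeroParts z)
      rearrange : ∀ q a b c d → q ℤ.* a ≡ c ℤ.+ ((q ℤ.* (a ℤ.+ b) ℤ.- (c ℤ.+ d)) ℤ.- (q ℤ.* b ℤ.- d))
      rearrange = solve-∀
      multichoose-pred : ∀ n → 0 ℕ.< n → multichoose n (suc m) ≡ multichoose (n ℕ.∸ 1) (suc m) ℕ.+ multichoose n m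
      multichoose-pred (suc n) _ = ≡.refl
      split : ∑comps q (suc m) (sumIs z) ≡ P ℤ.+ ∑comps q m (sumIs z)
      split = ≡.trans (∑comps-remove q m (to 0#) (sumIs z))
        (≡.cong (ℤ._+_ P) (∑comps-cong q m (λ v → δ-cong z
          (trans (weightedSum-updateAt from v (to 0#)) (trans (+-congʳ (strictlyInverseʳ 0#)) (+-identityˡ _))))))

    private
      multiple : ∀ z j → excess z (j ℕ.* p) ≡ excess z 0 ℤ.* + multichoose s j
      multiple z = excess-multiple (suc p″) s (excess z) (excess-euler z)

      nonmultiple : ∀ z i j → i ≢ 0 → i ℕ.< p → excess z (i ℕ.+ j ℕ.* p) ≡ ℤ.0ℤ
      nonmultiple z = excess-nonmultiple (suc p″) s (excess z) (excess-euler z)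

    -- For positive `j` the preceding size has residue `p - 1`, which is nonzero, so only the excess
    -- at `j * p` survives in the difference.
    Ptilde-multiple : ∀ z j → + q ℤ.* + Ptilde F enum (j ℕ.* p) z ≡
                      + multichoose (q ℕ.∸ 1) (j ℕ.* p) ℤ.+ excess z 0 ℤ.* + multichoose s j
    Ptilde-multiple z zero = ≡.trans (Ptilde-zero z)
      (≡.cong₂ (λ a b → + a ℤ.+ b) (≡.sym (multichoose-0 (q ℕ.∸ 1))) (multiple z 0))
    Ptilde-multiple z (suc j) = ≡.trans (Ptilde-suc (suc p″ ℕ.+ j ℕ.* p) z)
      (≡.cong (ℤ._+_ (+ multichoose (q ℕ.∸ 1) (suc j ℕ.* p)))
        (≡.trans (≡.cong₂ ℤ._-_ (multiple z (suc j)) (nonmultiple z (suc p″) j (λ ()) (ℕ.n<1+n (suc p″))))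
                 (ℤ.+-identityʳ (excess z 0 ℤ.* + multichoose s (suc j)))))

    -- Now the subtracted excess survives, whence the sign: residue 1 is nonzero modulo `p`, and the
    -- preceding size is `j * p`.
    Ptilde-multiple+1 : ∀ z j → + q ℤ.* + Ptilde F enum (1 ℕ.+ j ℕ.* p) z ≡
                        + multichoose (q ℕ.∸ 1) (1 ℕ.+ j ℕ.* p) ℤ.+ ℤ.- (excess z 0 ℤ.* + multichoose s j)
    Ptilde-multiple+1 z j = ≡.trans (Ptilde-suc (j ℕ.* p) z)
      (≡.cong (ℤ._+_ (+ multichoose (q ℕ.∸ 1) (1 ℕ.+ j ℕ.* p)))
        (≡.trans (≡.cong₂ ℤ._-_ (nonmultiple z 1 j (λ ()) (ℕ.s<s ℕ.z<s)) (multiple z j))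
                 (ℤ.+-identityˡ (ℤ.- (excess z 0 ℤ.* + multichoose s j)))))

    -- Both `i` and `i - 1` are nonzero residues, so both excesses vanish.
    Ptilde-generic : ∀ z i j → i ≢ 0 → i ≢ 1 → i ℕ.< p → + q ℤ.* + Ptilde F enum (i ℕ.+ j ℕ.* p) z ≡
                     + multichoose (q ℕ.∸ 1) (i ℕ.+ j ℕ.* p) ℤ.+ ℤ.0ℤ
    Ptilde-generic z 0             j i≢0 i≢1 i<p = contradiction ≡.refl i≢0
    Ptilde-generic z 1             j i≢0 i≢1 i<p = contradiction ≡.refl i≢1
    Ptilde-generic z (suc (suc i)) j i≢0 i≢1 i<p = ≡.trans (Ptilde-suc (suc i ℕ.+ j ℕ.* p) z)
      (≡.cong (ℤ._+_ (+ multichoose (q ℕ.∸ 1) (suc (suc i) ℕ.+ j ℕ.* p)))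
        (≡.cong₂ ℤ._-_ (nonmultiple z (suc (suc i)) j (λ ()) i<p)
                       (nonmultiple z (suc i) j (λ ()) (ℕ.<-trans (ℕ.n<1+n (suc i)) i<p))))

module Quotients where

  open import Data.Nat as ℕ using (ℕ; suc; NonZero)
  open import Data.Integer as ℤ using (ℤ; +_)
  import Data.Integer.Properties as ℤ
  open import Data.Integer.Tactic.RingSolver using (solve-∀)
  open import Data.Rational using (_/_; _+_; -_; toℚᵘ)
  open import Data.Rational.Properties using (toℚᵘ-injective; toℚᵘ-fromℚᵘ; toℚᵘ-homo-+; 0/n≡0)
  open import Data.Rational.Unnormalised as ℚᵘ using (mkℚᵘ; *≡*)
  import Data.Rational.Unnormalised.Properties as ℚᵘ
  open import Relation.Binary.PropositionalEquality

  -- From integer identities to rational quotients.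

  /-cong-numerator : ∀ q .{{_ : NonZero q}} {a b} → a ≡ b → a / q ≡ b / q
  /-cong-numerator q = cong (_/ q)

  -- The quotient of a negative numerator is by definition the negated quotient of its absolute
  -- value; only numerator 0 needs an argument.
  /-neg : ∀ q .{{_ : NonZero q}} n {a} → a ≡ ℤ.- (+ n) → a / q ≡ - ((+ n) / q)
  /-neg q ℕ.zero  refl = trans (0/n≡0 q) (sym (cong -_ (0/n≡0 q)))
  /-neg q (suc n) refl = refl

  -- For unnormalised rationals the claim is a cross-multiplied integer identity. The free `d` lets
  -- every branch of `D` keep its own form.
  divide-sum : ∀ q .{{_ : NonZero q}} n a b {d} → + q ℤ.* n ≡ a ℤ.+ b → b / q ≡ d → n / 1 ≡ a / q + d
  divide-sum q@(suc q-1) n a b qn≡a+b refl = toℚᵘ-injective (begin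
    toℚᵘ (n / 1)                    ≈⟨ toℚᵘ-fromℚᵘ (mkℚᵘ n 0) ⟩
    mkℚᵘ n 0                        ≈⟨ *≡* cross ⟩
    mkℚᵘ a q-1 ℚᵘ.+ mkℚᵘ b q-1      ≈⟨ ℚᵘ.+-cong (toℚᵘ-fromℚᵘ (mkℚᵘ a q-1)) (toℚᵘ-fromℚᵘ (mkℚᵘ b q-1)) ⟨
    toℚᵘ (a / q) ℚᵘ.+ toℚᵘ (b / q)  ≈⟨ toℚᵘ-homo-+ (a / q) (b / q) ⟨
    toℚᵘ (a / q + b / q)            ∎)
    where
    open import Relation.Binary.Reasoning.Setoid ℚᵘ.≃-setoid
    assoc-swap : ∀ q n → n ℤ.* (q ℤ.* q) ≡ (q ℤ.* n) ℤ.* q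
    assoc-swap = solve-∀
    factor : ∀ a b q → (a ℤ.+ b) ℤ.* q ≡ (a ℤ.* q ℤ.+ b ℤ.* q)
    factor = solve-∀
    cross : n ℤ.* (+ q ℤ.* + q) ≡ (a ℤ.* + q ℤ.+ b ℤ.* + q) ℤ.* + 1
    cross = trans (assoc-swap (+ q) n)
      (trans (cong (ℤ._* + q) qn≡a+b) (trans (factor a b (+ q)) (sym (ℤ.*-identityʳ _))))

open import Defs
open import Algebra.Bundles using (CommutativeRing)
open import Data.Nat using (ℕ; _+_; _∸_; _^_)
open import Data.Nat.Primality using (Prime)
open import Data.Nat.Combinatorics using (_C_)
open import Data.Integer using (+_)
open import Data.Rational using (_/_)
open import Data.Rational using () renaming (_+_ to _+ℚ_)
open import Relation.Binary.PropositionalEquality using (_≡_)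

open import Data.Nat as ℕ using (zero; suc; _<_; _≟_; NonZero)
import Data.Nat.Properties as ℕ
open import Data.Nat.DivMod as ℕ using (_%_; m%n<n; m≡m%n+[m/n]*n; m*n/n≡m)
open import Data.Nat.Primality using (prime⇒nonZero; ¬prime[0]; ¬prime[1])
open import Data.Integer as ℤ using (ℤ)
import Data.Integer.Properties as ℤ
open import Data.Rational as ℚ using (ℚ; 0ℚ)
open import Data.Rational.Properties using (0/n≡0)
import Data.Fin as Fin
open import Data.Empty using (⊥-elim)
open import Function.Bundles using (Inverse)
open import Relation.Nullary using (yes; no)
open import Relation.Binary.PropositionalEquality using (_≢_; refl; sym; trans; cong; cong₂; subst)
open Counting using (multichoose; multichoose≡C; indicator-yes; indicator-no)
open Quotients
open FiniteField using (module SubsetSums; module Partitions)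

-- Binomial form of the coefficients and the cases of `D`.

multichoose-pred≡C : ∀ q m → 1 < q → multichoose (q ∸ 1) m ≡ (q + m ∸ 2) C m
multichoose-pred≡C (suc (suc n)) m _ = multichoose≡C n m
multichoose-pred≡C 1 m (ℕ.s≤s ())

multichoose≡C-pred : ∀ s j → NonZero s → multichoose s j ≡ (s ∸ 1 + j) C j
multichoose≡C-pred (suc s) j _ = multichoose≡C s j

module _ {c ℓ} (F : CommutativeRing c ℓ) {p : ℕ} (r : ℕ) (pr : Prime p) (enum : FiniteWith F (p ^ r))
         (m : ℕ) (z : CommutativeRing.Carrier F) where

  open CommutativeRing F using (0#)
  open Inverse enum using (to)

  private
    instance
      p≢0 : NonZero p
      p≢0 = prime⇒nonZero pr
      q≢0 : NonZero (p ^ r)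
      q≢0 = pow-nonZero pr r
    q B : ℕ
    q = p ^ r
    B = (q ℕ./ p ∸ 1 + m ℕ./ p) C (m ℕ./ p)

  -- A record, since with-abstraction would normalise the rational numbers in the
  -- types of these cases if they were separate arguments of D-elim.
  record DCases {a} (Q : ℚ → Set a) : Set a where
    field
      multiple-zero      : m % p ≡ 0 → to z ≡ to 0# → Q ((+ ((q ∸ 1) ℕ.* B)) / q)
      multiple-nonzero   : m % p ≡ 0 → to z ≢ to 0# → Q (ℚ.- ((+ B) / q))
      multiple+1-zero    : m % p ≡ 1 → to z ≡ to 0# → Q (ℚ.- ((+ ((q ∸ 1) ℕ.* B)) / q))
      multiple+1-nonzero : m % p ≡ 1 → to z ≢ to 0# → Q ((+ B) / q)
      generic            : m % p ≢ 0 → m % p ≢ 1 → Q 0ℚ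

  -- The same three tests as in `D` are made, so `D` reduces to its value in every branch.
  D-elim : ∀ {a} {Q : ℚ → Set a} → DCases Q → Q (D F r pr enum m z)
  D-elim cases with m % p ≟ 0 | m % p ≟ 1 | to z Fin.≟ to 0#
  ... | yes m≡0 | _       | yes z≡0 = DCases.multiple-zero cases m≡0 z≡0
  ... | yes m≡0 | _       | no z≢0  = DCases.multiple-nonzero cases m≡0 z≢0
  ... | no _    | yes m≡1 | yes z≡0 = DCases.multiple+1-zero cases m≡1 z≡0
  ... | no _    | yes m≡1 | no z≢0  = DCases.multiple+1-nonzero cases m≡1 z≢0
  ... | no m≢0  | no m≢1  | _       = DCases.generic cases m≢0 m≢1

theorem1 : ∀ {c ℓ} (F : CommutativeRing c ℓ) → IsField F →
    (p r : ℕ) (pr : Prime p) (enum : FiniteWith F (p ^ r)) →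
    (m : ℕ) (z : CommutativeRing.Carrier F) →
    ((+ Ptilde F enum m z) / 1)
    ≡ (((+ ((p ^ r + m ∸ 2) C m)) / (p ^ r)) {{pow-nonZero pr r}} +ℚ D F r pr enum m z)
theorem1 F F-field zero              r       pr enum m z = ⊥-elim (¬prime[0] pr)
theorem1 F F-field (suc zero)        r       pr enum m z = ⊥-elim (¬prime[1] pr)
-- `p ^ 0 = 1` element is too few for a field.
theorem1 F F-field p@(suc (suc _))   zero    pr enum m z =
  ⊥-elim (ℕ.<-irrefl refl (SubsetSums.order>1 F F-field enum))
theorem1 F F-field p@(suc (suc p″))  (suc r) pr enum m z =
  -- In each case the integer passed to `at-m` is `q D_m(z)`, and the last argument identifies its
  -- quotient by `q` with the value of `D`.
  D-elim F (suc r) pr enum m z {Q = λ d → (+ Ptilde F enum m z) / 1 ≡ (+ ((q + m ∸ 2) C m)) / q +ℚ d} record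
    { multiple-zero      = λ m%p≡0 z≡0 → at-m 0 X₀ m%p≡0 (Ptilde-multiple z j)
                             (/-cong-numerator q (excess-zero z≡0))
    ; multiple-nonzero   = λ m%p≡0 z≢0 → at-m 0 X₀ m%p≡0 (Ptilde-multiple z j)
                             (/-neg q B (excess-nonzero z≢0))
    ; multiple+1-zero    = λ m%p≡1 z≡0 → at-m 1 (ℤ.- X₀) m%p≡1 (Ptilde-multiple+1 z j)
                             (/-neg q ((q ∸ 1) ℕ.* B) (cong ℤ.-_ (excess-zero z≡0)))
    ; multiple+1-nonzero = λ m%p≡1 z≢0 → at-m 1 (ℤ.- X₀) m%p≡1 (Ptilde-multiple+1 z j)
                             (/-cong-numerator q (trans (cong ℤ.-_ (excess-nonzero z≢0)) (ℤ.neg-involutive (+ B))))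
    ; generic            = λ m%p≢0 m%p≢1 → at-m (m % p) ℤ.0ℤ refl
                             (Ptilde-generic z (m % p) j m%p≢0 m%p≢1 (m%n<n m p)) (0/n≡0 q)
    }
  where
  open CommutativeRing F using (0#)
  open Inverse enum using (to)
  open SubsetSums F F-field enum using (order>1)
  open Partitions F F-field p″ r pr enum

  q s j B : ℕ
  q = p ^ suc r
  s = p ^ r
  j = m ℕ./ p
  B = (q ℕ./ p ∸ 1 + j) C j

  instance
    q≢0 : NonZero q
    q≢0 = pow-nonZero pr (suc r)

  -- The exact quotient `q / p` is `s`.
  B≡multichoose : multichoose s j ≡ B
  B≡multichoose = trans (multichoose≡C-pred s j (pow-nonZero pr r))
    (cong (λ t → (t ∸ 1 + j) C j) (sym (trans (cong (ℕ._/ p) (ℕ.*-comm p s)) (m*n/n≡m s p))))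

  X₀ : ℤ
  X₀ = excess z 0 ℤ.* + multichoose s j

  at-m : ∀ i X {d} → m % p ≡ i →
         + q ℤ.* + Ptilde F enum (i + j ℕ.* p) z ≡ + multichoose (q ∸ 1) (i + j ℕ.* p) ℤ.+ X →
         X / q ≡ d → (+ Ptilde F enum m z) / 1 ≡ (+ ((q + m ∸ 2) C m)) / q +ℚ d
  at-m i X m%p≡i eq = divide-sum q (+ Ptilde F enum m z) (+ ((q + m ∸ 2) C m)) X
    (trans (subst (λ n → + q ℤ.* + Ptilde F enum n z ≡ + multichoose (q ∸ 1) n ℤ.+ X) (sym m≡i+jp) eq)
           (cong (λ n → + n ℤ.+ X) (multichoose-pred≡C q m order>1)))
    where
    m≡i+jp : m ≡ i + j ℕ.* p
    m≡i+jp = trans (m≡m%n+[m/n]*n m p) (cong (_+ j ℕ.* p) m%p≡i)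

  -- The empty multiset has sum `z`, so the initial excess is `q - 1`.
  excess-zero : to z ≡ to 0# → X₀ ≡ + ((q ∸ 1) ℕ.* B)
  excess-zero z≡0 = trans (cong₂ ℤ._*_ e≡ (cong +_ B≡multichoose)) (sym (ℤ.pos-* (q ∸ 1) B))
    where
    q-1 : ∀ q .{{_ : NonZero q}} → + q ℤ.* ℤ.1ℤ ℤ.- ℤ.1ℤ ≡ + (q ∸ 1)
    q-1 (suc n) = cong (ℤ._- ℤ.1ℤ) (ℤ.*-identityʳ (+ suc n))
    e≡ : excess z 0 ≡ + (q ∸ 1)
    e≡ = trans (excess-0 z)
      (trans (cong (λ d → + q ℤ.* d ℤ.- ℤ.1ℤ) (indicator-yes (to 0# Fin.≟ to z) (sym z≡0))) (q-1 q))

  -- The empty multiset misses the sum `z`, so the initial excess is `-1`.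
  excess-nonzero : to z ≢ to 0# → X₀ ≡ ℤ.- (+ B)
  excess-nonzero z≢0 = trans (cong₂ ℤ._*_ e≡ (cong +_ B≡multichoose)) (ℤ.-1*i≡-i (+ B))
    where
    e≡ : excess z 0 ≡ ℤ.-1ℤ
    e≡ = trans (excess-0 z)
      (trans (cong (λ d → + q ℤ.* d ℤ.- ℤ.1ℤ) (indicator-no (to 0# Fin.≟ to z) (λ eq → z≢0 (sym eq))))
             (cong (ℤ._- ℤ.1ℤ) (ℤ.*-zeroʳ (+ q))))
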